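{- Let $G$ be a graph with $n$ vertices and minimum degree $\delta$. If $\alpha_{ir}(G)=1$, then (i) $n_k \geq n-k$ for any $k \in D(G)$; (ii) $span(G) \leq \frac{1}{2}\left(1+\sqrt{1+8 \delta}\right)$. Moreover, the bound in (ii) is sharp: there exist graphs $G$ with $\alpha_{ir}(G)=1$ for which equality holds.
   Context: All graphs are finite, simple, undirected and have at least one vertex. An irregular independent set of $G$ is an independent set $A$ of $G$ such that any two distinct vertices in $A$ have different degrees in $G$; $\alpha_{ir}(G)$ is the size of a largest irregular independent set of $G$. $D(G)$ denotes the set of degrees of vertices of $G$, and $span(G) = |D(G)|$ is the number of distinct vertex degrees of $G$. For $k \in D(G)$, $n_k$ denotes the number of vertices of $G$ of degree $k$. -}

module Defs where

open import Data.Bool.Base using (true; false)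
open import Data.Empty using (⊥)
open import Data.Fin.Base using (Fin)
import Data.Fin.Properties as Fin
open import Data.Fin.Subset using (Subset; inside; outside; ∣_∣)
  renaming (_∈_ to _∈ₛ_)
open import Data.Fin.Subset.Properties using (_∈?_)
import Data.Integer.Base as ℤ
open import Data.List.Base using (List; []; _∷_; _++_; map; filter; length; allFin; deduplicate)
open import Data.List.Extrema.Nat using (min; max)
open import Data.List.Membership.Propositional using (_∈_)
open import Data.List.Membership.Propositional.Properties using (∈-map⁺; ∈-++⁺ˡ; ∈-++⁺ʳ)
open import Data.List.Relation.Unary.Any using (here)
open import Data.Nat.Base as ℕ using (ℕ; zero; suc)
import Data.Nat.Properties as ℕ
open import Data.Product.Base using (_×_; _,_; ∃-syntax)
open import Data.Rational.Base as ℚ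
  using (ℚ; 0ℚ; 1ℚ; _<_; _≤_; _+_; _*_; _-_; -_; 1/_; _/_; NonNegative; Positive)
open import Data.Rational.Properties as ℚ
open import Data.Sum.Base using (_⊎_; inj₁; inj₂)
open import Data.Vec.Base as Vec using ([]; _∷_; tabulate)
open import Level using (0ℓ)
open import Relation.Binary.Core using (Rel)
open import Relation.Binary.Definitions
  using (Decidable; Symmetric; Irreflexive; tri<; tri≈; tri>)
open import Relation.Binary.PropositionalEquality
open import Relation.Nullary.Decidable using (Dec; does; ¬?; _×-dec_; _→-dec_)
open import Relation.Nullary.Negation using (¬_)

------------------------------------------------------------------------
-- Graphs

-- Every finite graph is isomorphic to one on Fin order.  Decidability of
-- adjacency is what makes degrees computable.
record Graph : Set₁ where
  field
    order       : ℕ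
    .{{order≢0}} : ℕ.NonZero order
    _~_         : Rel (Fin order) 0ℓ
    _~?_        : Decidable _~_
    ~-sym       : Symmetric _~_
    ~-irrefl    : Irreflexive _≡_ _~_

module _ (G : Graph) where
  open Graph G

  neighbours : Fin order → Subset order
  neighbours v = tabulate (λ w → does (v ~? w))

  degree : Fin order → ℕ
  degree v = ∣ neighbours v ∣

  degrees : List ℕ
  degrees = map degree (allFin order)

  D : List ℕ
  D = deduplicate ℕ._≟_ degrees

  span : ℕ
  span = length D

  countOfDegree : ℕ → ℕ
  countOfDegree k = length (filter (λ v → degree v ℕ.≟ k) (allFin order))

  -- All degrees are smaller than the order and there is at least one vertex,
  -- so the seed order is never the minimum.
  minDegree : ℕ
  minDegree = min order degrees

  Independent : Subset order → Set
  Independent A = ∀ u → u ∈ₛ A → ∀ v → v ∈ₛ A → ¬ (u ~ v)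

  IrregularIndependent : Subset order → Set
  IrregularIndependent A =
    Independent A ×
    (∀ u → u ∈ₛ A → ∀ v → v ∈ₛ A → u ≢ v → degree u ≢ degree v)

  irregularIndependent? : ∀ A → Dec (IrregularIndependent A)
  irregularIndependent? A =
    Fin.all? (λ u → (u ∈? A) →-dec
      Fin.all? (λ v → (v ∈? A) →-dec ¬? (u ~? v)))
    ×-dec
    Fin.all? (λ u → (u ∈? A) →-dec
      Fin.all? (λ v → (v ∈? A) →-dec
        (¬? (u Fin.≟ v) →-dec ¬? (degree u ℕ.≟ degree v))))

subsets : ∀ n → List (Subset n)
subsets zero    = [] ∷ []
subsets (suc n) = map (inside ∷_) (subsets n) ++ map (outside ∷_) (subsets n)

subsets-complete : ∀ {n} (A : Subset n) → A ∈ subsets n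
subsets-complete []          = here refl
subsets-complete (true  ∷ A) = ∈-++⁺ˡ (∈-map⁺ (inside ∷_) (subsets-complete A))
subsets-complete {suc n} (false ∷ A) =
  ∈-++⁺ʳ (map (inside ∷_) (subsets n)) (∈-map⁺ (outside ∷_) (subsets-complete A))

-- The seed 0 is harmless: the empty set is irregular independent.
α-ir : Graph → ℕ
α-ir G = max 0 (map ∣_∣ (filter (irregularIndependent? G) (subsets (Graph.order G))))

------------------------------------------------------------------------
-- Real numbers as two-sided Dedekind cuts

record ℝ : Set₁ where
  field
    _∈L : ℚ → Set
    _∈U : ℚ → Set
    L-inhabited : ∃[ q ] q ∈L
    U-inhabited : ∃[ q ] q ∈U
    L-lower     : ∀ {p q} → p < q → q ∈L → p ∈L
    U-upper     : ∀ {p q} → p < q → p ∈U → q ∈U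
    L-open      : ∀ {p} → p ∈L → ∃[ q ] (p < q × q ∈L)
    U-open      : ∀ {q} → q ∈U → ∃[ p ] (p < q × p ∈U)
    disjoint    : ∀ {q} → q ∈L → q ∈U → ⊥
    located     : ∀ {p q} → p < q → p ∈L ⊎ q ∈U

infix 4 _≤ℝ_ _≈ℝ_

_≤ℝ_ : ℝ → ℝ → Set
x ≤ℝ y = ∀ q → ℝ._∈L x q → ℝ._∈L y q

_≈ℝ_ : ℝ → ℝ → Set
x ≈ℝ y = x ≤ℝ y × y ≤ℝ x

fromℚ : ℚ → ℝ
fromℚ r = record
  { _∈L = λ q → q < r
  ; _∈U = λ q → r < q
  ; L-inhabited = r - 1ℚ , subst (r - 1ℚ <_) (+-identityʳ r) (+-monoʳ-< r (negative⁻¹ (- 1ℚ)))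
  ; U-inhabited = r + 1ℚ , subst (_< r + 1ℚ) (+-identityʳ r) (+-monoʳ-< r (positive⁻¹ 1ℚ))
  ; L-lower = <-trans
  ; U-upper = λ p<q r<p → <-trans r<p p<q
  ; L-open = λ p<r → <-dense p<r
  ; U-open = λ r<q → let m , r<m , m<q = <-dense r<q in m , m<q , r<m
  ; disjoint = <-asym
  ; located = loc
  }
  where
  loc : ∀ {p q} → p < q → p < r ⊎ r < q
  loc {p} p<q with <-cmp p r
  ... | tri< p<r _ _    = inj₁ p<r
  ... | tri≈ _ refl _   = inj₂ p<q
  ... | tri> _ _ r<p    = inj₂ (<-trans r<p p<q)

fromℕ : ℕ → ℝ
fromℕ n = fromℚ (ℤ.+ n / 1)

infixr 6 _⊕_
infixr 7 _⊛_

-- A cut is moved along an increasing bijection f of ℚ by pulling it back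
-- along the inverse g.
private
  transport : (f g : ℚ → ℚ) →
              (∀ {p q} → p < q → f p < f q) → (∀ {p q} → p < q → g p < g q) →
              (∀ q → f (g q) ≡ q) → (∀ q → g (f q) ≡ q) → ℝ → ℝ
  transport f g f-mono g-mono fg gf x = record
    { _∈L = λ q → g q ∈L
    ; _∈U = λ q → g q ∈U
    ; L-inhabited = let q , l = L-inhabited in f q , subst _∈L (sym (gf q)) l
    ; U-inhabited = let q , u = U-inhabited in f q , subst _∈U (sym (gf q)) u
    ; L-lower = λ p<q → L-lower (g-mono p<q)
    ; U-upper = λ p<q → U-upper (g-mono p<q)
    ; L-open = λ {p} l → let q , lt , l′ = L-open l in
        f q , subst (_< f q) (fg p) (f-mono lt) , subst _∈L (sym (gf q)) l′
    ; U-open = λ {q} u → let p , lt , u′ = U-open u in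
        f p , subst (f p <_) (fg q) (f-mono lt) , subst _∈U (sym (gf p)) u′
    ; disjoint = disjoint
    ; located = λ p<q → located (g-mono p<q)
    }
    where open ℝ x

  cancel : ∀ a b q → a + b ≡ 0ℚ → a + (b + q) ≡ q
  cancel a b q eq = trans (sym (+-assoc a b q)) (trans (cong (_+ q) eq) (+-identityˡ q))

  cancel* : ∀ a b q → a * b ≡ 1ℚ → a * (b * q) ≡ q
  cancel* a b q eq = trans (sym (*-assoc a b q)) (trans (cong (_* q) eq) (*-identityˡ q))

-- Addition of a rational: q < r + x iff - r + q < x.
_⊕_ : ℚ → ℝ → ℝ
r ⊕ x = transport (r +_) (- r +_) (+-monoʳ-< r) (+-monoʳ-< (- r))
  (λ q → cancel r (- r) q (+-inverseʳ r)) (λ q → cancel (- r) r q (+-inverseˡ r)) x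

-- Multiplication by a positive rational: q < r x iff q / r < x.
_⊛_ : (r : ℚ) .{{_ : Positive r}} → ℝ → ℝ
r ⊛ x = transport (r *_) (1/ r *_) (*-monoʳ-<-pos r) (*-monoʳ-<-pos (1/ r))
  (λ q → cancel* r (1/ r) q (*-inverseʳ r)) (λ q → cancel* (1/ r) r q (*-inverseˡ r)) x
  where instance
    _ = pos⇒nonZero r
    _ = 1/pos⇒pos r

-- √ a is the common value of sup { r ∣ r² ≤ a } and inf { r ≥ 0 ∣ a ≤ r² },
-- taken over the rationals r.
√ : (a : ℚ) .{{_ : NonNegative a}} → ℝ
√ a = record
  { _∈L = λ q → ∃[ r ] (q < r × r * r ≤ a)
  ; _∈U = λ q → ∃[ r ] (r < q × 0ℚ ≤ r × a ≤ r * r)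
  ; L-inhabited = - 1ℚ , 0ℚ , negative⁻¹ (- 1ℚ) , 0≤a
  ; U-inhabited = a + 1ℚ + 1ℚ , a + 1ℚ , x<x+1 (a + 1ℚ) , ≤-trans 0≤a (<⇒≤ (x<x+1 a)) , a≤[a+1]²
  ; L-lower = λ { p<q (r , q<r , le) → r , <-trans p<q q<r , le }
  ; U-upper = λ { p<q (r , r<p , le) → r , <-trans r<p p<q , le }
  ; L-open = λ { (r , p<r , le) → let m , p<m , m<r = <-dense p<r in m , p<m , r , m<r , le }
  ; U-open = λ { (r , r<q , le) → let m , r<m , m<q = <-dense r<q in m , m<q , r , r<m , le }
  ; disjoint = λ { (r , q<r , r²≤a) (s , s<q , 0≤s , a≤s²) →
      <-irrefl refl (<-≤-trans (square-< 0≤s (<-trans s<q q<r)) (≤-trans r²≤a a≤s²)) }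
  ; located = loc
  }
  where
  0≤a : 0ℚ ≤ a
  0≤a = nonNegative⁻¹ a

  x<x+1 : ∀ x → x < x + 1ℚ
  x<x+1 x = subst (_< x + 1ℚ) (+-identityʳ x) (+-monoʳ-< x (positive⁻¹ 1ℚ))

  a≤[a+1]² : a ≤ (a + 1ℚ) * (a + 1ℚ)
  a≤[a+1]² = ≤-trans (<⇒≤ (x<x+1 a)) (subst (_≤ (a + 1ℚ) * (a + 1ℚ)) (*-identityʳ (a + 1ℚ))
    (*-monoˡ-≤-nonNeg (a + 1ℚ) {{ℚ.nonNegative (≤-trans 0≤a (<⇒≤ (x<x+1 a)))}}
      (subst (_≤ a + 1ℚ) (+-identityˡ 1ℚ) (+-monoˡ-≤ 1ℚ 0≤a))))

  square-< : ∀ {s r} → 0ℚ ≤ s → s < r → s * s < r * r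
  square-< {s} {r} 0≤s s<r =
    ≤-<-trans (*-monoˡ-≤-nonNeg s {{ℚ.nonNegative 0≤s}} (<⇒≤ s<r))
              (*-monoˡ-<-pos r {{ℚ.positive (≤-<-trans 0≤s s<r)}} s<r)

  loc : ∀ {p q} → p < q →
        (∃[ r ] (p < r × r * r ≤ a)) ⊎ (∃[ r ] (r < q × 0ℚ ≤ r × a ≤ r * r))
  loc p<q with <-dense p<q
  ... | m , p<m , m<q with ≤-total 0ℚ m
  ...   | inj₂ m≤0 = inj₁ (0ℚ , <-≤-trans p<m m≤0 , 0≤a)
  ...   | inj₁ 0≤m with ≤-total (m * m) a
  ...     | inj₁ m²≤a = inj₁ (m , p<m , m²≤a)
  ...     | inj₂ a≤m² = inj₂ (m , m<q , 0≤m , a≤m²)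

√ℕ : ℕ → ℝ
√ℕ n = √ (ℤ.+ n / 1) {{normalize-nonNeg n 1}}

{-# OPTIONS --safe #-}

-- If α-ir G ≡ 1 then vertices of different degrees are adjacent, so a vertex v
-- of degree k has all n - n_k vertices of other degrees as neighbours; this is
-- (i).  Summing (i) over D G gives (n - δ) + Σ_{k ≠ δ} (n - k) ≤ Σ n_k ≤ n, that
-- is, Σ_{k ≠ δ} (n - k) ≤ δ.  With s = span G, the left-hand side is a sum of
-- s - 1 distinct positive integers, so s (s - 1) ≤ 2 δ and (2 s - 1)² ≤ 1 + 8 δ.
-- Equality is attained by the one-vertex graph.
module Submission where

open import Defs
open import Data.Bool.Base using (true; false)
open import Data.Empty using (⊥)
open import Data.Fin.Base using (Fin; zero; suc)
open import Data.Fin.Subset using (⊤; ⁅_⁆; _∪_; ∣_∣) renaming (_∈_ to _∈ₛ_)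
open import Data.Fin.Subset.Properties using
  (x∈⁅x⁆; x∈⁅y⁆⇒x≡y; ∣⁅x⁆∣≡1; p⊆p∪q; q⊆p∪q; x∈p∪q⁻; p⊂q⇒∣p∣<∣q∣; ⊆-max; ∈⊤; ∣⊤∣≡n)
import Data.Integer.Base as ℤ
import Data.Integer.Properties as ℤ
open import Data.List.Base using (List; []; _∷_; map; filter; length; allFin; tabulate)
open import Data.List.Extrema.Nat using (min≤xs; xs≤max; argmin-sel)
open import Data.List.Membership.Propositional using (_∈_)
open import Data.List.Membership.DecPropositional using (_∈?_)
open import Data.List.Membership.Propositional.Properties using
  (∈-∃++; ∈-map⁺; ∈-map⁻; ∈-filter⁺; ∈-allFin; ∈-deduplicate⁺; ∈-deduplicate⁻)
open import Data.List.Properties using (filter-accept; filter-reject; length-tabulate; map-cong-local)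
open import Data.List.Relation.Binary.Permutation.Propositional using (_↭_; ↭⇒↭ₛ)
open import Data.List.Relation.Binary.Permutation.Propositional.Properties using
  (shift; map⁺; All-resp-↭; ↭-length)
open import Data.List.Relation.Binary.Permutation.Setoid.Properties using (Unique-resp-↭)
open import Data.List.Relation.Unary.All as All using (All; []; _∷_)
open import Data.List.Relation.Unary.All.Properties using (¬Any⇒All¬)
open import Data.List.Relation.Unary.AllPairs using ([]; _∷_)
open import Data.List.Relation.Unary.Unique.Propositional using (Unique)
open import Data.List.Relation.Unary.Unique.DecPropositional.Properties using (deduplicate-!)
open import Data.Nat.Base using
  (ℕ; zero; suc; _+_; _*_; _∸_; _≥_; _≤_; _<_; z≤n; s≤s; s≤s⁻¹; NonZero)
open import Data.Nat.Coprimality as Coprime using (1-coprimeTo)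
open import Data.Nat.ListAction using (sum)
open import Data.Nat.ListAction.Properties using (sum-↭)
open import Data.Nat.Properties as ℕ hiding (_≟_)
open import Data.Nat.Tactic.RingSolver using (solve-∀)
open import Data.Product.Base using (_×_; _,_; ∃-syntax; proj₁; proj₂)
open import Data.Rational.Base as ℚ using (ℚ; ½; 0ℚ; 1ℚ; mkℚ)
import Data.Rational.Properties as ℚ
open import Data.Sum.Base using (_⊎_; inj₁; inj₂)
import Data.Vec.Base as Vec
open import Data.Vec.Properties using (lookup∘tabulate; []=⇒lookup)
open import Function.Base using (_∘_; case_of_; id)
open import Level using (0ℓ)
open import Relation.Binary.PropositionalEquality using
  (_≡_; _≢_; refl; sym; trans; cong; cong₂; subst; setoid; module ≡-Reasoning)
open import Relation.Nullary.Decidable using (does; yes; no; decidable-stable)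
open import Relation.Nullary.Negation using (¬_; contradiction)
open import Relation.Unary using (Pred; Decidable)

-- Counting in lists

∈⇒↭∷ : ∀ {A : Set} {x : A} {xs} → x ∈ xs → ∃[ ys ] xs ↭ x ∷ ys
∈⇒↭∷ x∈xs with ys , zs , refl ← ∈-∃++ x∈xs = _ , shift _ ys zs

Unique-↭ : ∀ {A : Set} {xs ys : List A} → xs ↭ ys → Unique xs → Unique ys
Unique-↭ {A} p = Unique-resp-↭ (setoid A) (↭⇒↭ₛ p)

-- Reconciles two ways of counting: `degree` is the size of a tabulated subset, `countOfDegree` the
-- length of a filtered list.
length-filter-tabulate : ∀ {A : Set} {P : Pred A 0ℓ} (P? : Decidable P) {n} (f : Fin n → A) →
  ∣ Vec.tabulate (does ∘ P? ∘ f) ∣ ≡ length (filter P? (tabulate f))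
length-filter-tabulate P? {zero}  f = refl
length-filter-tabulate P? {suc n} f with does (P? (f zero))
... | true  = cong suc (length-filter-tabulate P? (f ∘ suc))
... | false = length-filter-tabulate P? (f ∘ suc)

length-filter-cover : ∀ {A : Set} {P Q : Pred A 0ℓ} (P? : Decidable P) (Q? : Decidable Q) →
  (∀ x → P x ⊎ Q x) → ∀ xs → length xs ≤ length (filter P? xs) + length (filter Q? xs)
length-filter-cover P? Q? cover [] = z≤n
length-filter-cover P? Q? cover (x ∷ xs)
  with ih ← length-filter-cover P? Q? cover xs | P? x | Q? x
... | yes _ | no _  = s≤s ih
... | yes _ | yes _ = s≤s (≤-trans ih (+-monoʳ-≤ _ (n≤1+n _)))
... | no _  | yes _ = subst (suc (length xs) ≤_) (sym (+-suc _ _)) (s≤s ih)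
... | no ¬p | no ¬q = case cover x of λ { (inj₁ p) → contradiction p ¬p ; (inj₂ q) → contradiction q ¬q }

sum-map-mono : ∀ {A : Set} {f g : A → ℕ} {xs} → All (λ x → f x ≤ g x) xs →
  sum (map f xs) ≤ sum (map g xs)
sum-map-mono []       = z≤n
sum-map-mono (p ∷ ps) = +-mono-≤ p (sum-map-mono ps)

module _ {A : Set} (f : A → ℕ) where

  -- For `f = degree G` and `xs = allFin order` this unfolds to `countOfDegree G`.
  fibre : List A → ℕ → ℕ
  fibre xs k = length (filter (λ x → f x ℕ.≟ k) xs)

  -- As `ks` has no repetitions, `f x` occurs in it at most once, so `x` enlarges at most one fibre.
  sum-fibres-∷ : ∀ x xs {ks} → Unique ks →
    sum (map (fibre (x ∷ xs)) ks) ≤ suc (sum (map (fibre xs) ks))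
  sum-fibres-∷ x xs [] = z≤n
  sum-fibres-∷ x xs {k ∷ ks} (k∉ks ∷ uniq) with f x ℕ.≟ k
  -- The remaining fibres do not change: their keys differ from `k`, hence from `f x`.
  ... | yes fx≡k = +-mono-≤
    (≤-reflexive (cong length (filter-accept (λ y → f y ℕ.≟ k) fx≡k)))
    (≤-reflexive (cong sum (map-cong-local (All.map
      (λ {j} k≢j → cong length (filter-reject (λ y → f y ℕ.≟ j) (k≢j ∘ trans (sym fx≡k)))) k∉ks))))
  ... | no  fx≢k = ≤-trans
    (+-mono-≤ (≤-reflexive (cong length (filter-reject (λ y → f y ℕ.≟ k) fx≢k))) (sum-fibres-∷ x xs uniq))
    (≤-reflexive (+-suc _ _))

  sum-fibres≤length : ∀ xs {ks} → Unique ks → sum (map (fibre xs) ks) ≤ length xs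
  sum-fibres≤length [] {ks} uniq = ≤-reflexive (sum-zeros ks)
    where
    sum-zeros : ∀ ks → sum (map (λ _ → 0) ks) ≡ 0
    sum-zeros []       = refl
    sum-zeros (_ ∷ ks) = sum-zeros ks
  sum-fibres≤length (x ∷ xs) uniq =
    ≤-trans (sum-fibres-∷ x xs uniq) (s≤s (sum-fibres≤length xs uniq))

-- Sums of distinct positive integers

sum-map-suc∸ : ∀ n {ks} → All (_≤ n) ks →
  sum (map (suc n ∸_) ks) ≡ length ks + sum (map (n ∸_) ks)
sum-map-suc∸ n [] = refl
sum-map-suc∸ n {k ∷ ks} (k≤n ∷ ks≤n) = begin
  (suc n ∸ k) + sum (map (suc n ∸_) ks)          ≡⟨ cong₂ _+_ (+-∸-assoc 1 k≤n) (sum-map-suc∸ n ks≤n) ⟩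
  suc (n ∸ k) + (length ks + sum (map (n ∸_) ks)) ≡⟨ swap (n ∸ k) (length ks) _ ⟩
  suc (length ks) + ((n ∸ k) + sum (map (n ∸_) ks)) ∎
  where
  open ≡-Reasoning
  swap : ∀ a b c → suc a + (b + c) ≡ suc b + (a + c)
  swap = solve-∀

-- Passing from n to suc n adds 1 to each of the summands, and possibly one new
-- summand equal to 1.
triangular≤2*sum : ∀ n {ks} → Unique ks → All (_< n) ks →
  length ks * suc (length ks) ≤ 2 * sum (map (n ∸_) ks)
triangular≤2*sum zero    _    []      = z≤n
triangular≤2*sum zero    _    (() ∷ _)
triangular≤2*sum (suc n) {ks} uniq bound with _∈?_ ℕ._≟_ n ks
-- No summand is new. With s = `length ks`, s (s + 1) is enlarged to s (s + 2) = 2 s + s²; the 2 s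
-- is twice the growth of the s summands, and the induction hypothesis bounds s².
... | no n∉ks = begin
  length ks * suc (length ks)                       ≤⟨ *-monoʳ-≤ (length ks) (n≤1+n _) ⟩
  length ks * suc (suc (length ks))                 ≡⟨ *-comm (length ks) _ ⟩
  suc (suc (length ks)) * length ks                 ≡⟨ expand (length ks) ⟩
  2 * length ks + length ks * length ks             ≤⟨ +-monoʳ-≤ (2 * length ks)
                                                        (≤-trans (*-monoʳ-≤ (length ks) (n≤1+n _)) (triangular≤2*sum n uniq ks<n)) ⟩
  2 * length ks + 2 * sum (map (n ∸_) ks)           ≡⟨ *-distribˡ-+ 2 (length ks) _ ⟨
  2 * (length ks + sum (map (n ∸_) ks))             ≡⟨ cong (2 *_) (sum-map-suc∸ n (All.map <⇒≤ ks<n)) ⟨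
  2 * sum (map (suc n ∸_) ks)                       ∎
  where
  open ≤-Reasoning
  ks<n : All (_< n) ks
  ks<n = All.zipWith (λ (k<1+n , n≢k) → ≤∧≢⇒< (s≤s⁻¹ k<1+n) (n≢k ∘ sym)) (bound , ¬Any⇒All¬ ks n∉ks)
  expand : ∀ s → suc (suc s) * s ≡ 2 * s + s * s
  expand = solve-∀
-- The entry `n` contributes the new summand `suc n ∸ n`, which is 1; the other entries `js` lie
-- below `n`, so the induction hypothesis applies to them.
... | yes n∈ks with js , ks↭ ← ∈⇒↭∷ n∈ks
               with n∉js ∷ uniq′ ← Unique-↭ ks↭ uniq
                  | _ ∷ bound′   ← All-resp-↭ ks↭ bound = begin
  length ks * suc (length ks)                         ≡⟨ cong (λ s → s * suc s) (↭-length ks↭) ⟩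
  suc (length js) * suc (suc (length js))             ≡⟨ expand (length js) ⟩
  2 * suc (length js) + length js * suc (length js)   ≤⟨ +-monoʳ-≤ (2 * suc (length js)) (triangular≤2*sum n uniq′ js<n) ⟩
  2 * suc (length js) + 2 * sum (map (n ∸_) js)       ≡⟨ *-distribˡ-+ 2 (suc (length js)) _ ⟨
  2 * suc (length js + sum (map (n ∸_) js))           ≡⟨ cong (λ m → 2 * suc m) (sum-map-suc∸ n (All.map <⇒≤ js<n)) ⟨
  2 * suc (sum (map (suc n ∸_) js))                   ≡⟨ cong (λ m → 2 * (m + sum (map (suc n ∸_) js))) (m+n∸n≡m 1 n) ⟨
  2 * sum (map (suc n ∸_) (n ∷ js))                   ≡⟨ cong (2 *_) (sum-↭ (map⁺ (suc n ∸_) ks↭)) ⟨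
  2 * sum (map (suc n ∸_) ks)                         ∎
  where
  open ≤-Reasoning
  js<n : All (_< n) js
  js<n = All.zipWith (λ (k<1+n , n≢k) → ≤∧≢⇒< (s≤s⁻¹ k<1+n) (n≢k ∘ sym)) (bound′ , n∉js)
  expand : ∀ s → suc s * suc (suc s) ≡ 2 * suc s + s * suc s
  expand = solve-∀

-- Degrees

module _ (G : Graph) where
  open Graph G

  -- A neighbourhood misses its own vertex by irreflexivity, so it is a proper subset of `⊤`.
  degree<order : ∀ v → degree G v < order
  degree<order v = subst (degree G v <_) (∣⊤∣≡n order)
    (p⊂q⇒∣p∣<∣q∣ (⊆-max _ , v , ∈⊤ , v∉neighbours))
    where
    v∉neighbours : ¬ (v ∈ₛ neighbours G v)
    v∉neighbours v∈ with v ~? v | trans (sym (lookup∘tabulate (does ∘ (v ~?_)) v)) ([]=⇒lookup v∈)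
    ... | yes v~v | _  = ~-irrefl refl v~v
    ... | no  _   | ()

  ∈D⇒degree : ∀ {k} → k ∈ D G → ∃[ v ] k ≡ degree G v
  ∈D⇒degree k∈D with v , _ , eq ← ∈-map⁻ (degree G) (∈-deduplicate⁻ ℕ._≟_ (degrees G) k∈D) = v , eq

  D-unique : Unique (D G)
  D-unique = deduplicate-! ℕ._≟_ (degrees G)

  D<order : All (_< order) (D G)
  D<order = All.tabulate λ k∈D → let v , eq = ∈D⇒degree k∈D in subst (_< order) (sym eq) (degree<order v)

  minDegree∈D : minDegree G ∈ D G
  minDegree∈D = ∈-deduplicate⁺ ℕ._≟_ (case argmin-sel id order (degrees G) of λ
    { (inj₁ min≡order) → contradiction
        (≤-trans (≤-reflexive (sym min≡order))
          (All.lookup (min≤xs order (degrees G)) (∈-map⁺ (degree G) (∈-allFin vertex))))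
        (<⇒≱ (degree<order vertex))
    ; (inj₂ min∈) → min∈ })
    where
    inhabited : ∀ n → .{{NonZero n}} → Fin n
    inhabited (suc n) = zero
    vertex : Fin order
    vertex = inhabited order

  -- Graphs with irregular independence number 1.

  module _ (α≡1 : α-ir G ≡ 1) where

    -- Two nonadjacent vertices of different degrees would form an irregular independent set of size
    -- 2. Decidability of adjacency turns this refutation into adjacency.
    degree-≢⇒~ : ∀ u v → degree G u ≢ degree G v → u ~ v
    degree-≢⇒~ u v du≢dv = decidable-stable (u ~? v) λ u≁v →
      <⇒≱ (pair-large (du≢dv ∘ cong (degree G)))
        (subst (∣ pair ∣ ≤_) α≡1 (All.lookup (xs≤max 0 _) (∈-map⁺ ∣_∣
          (∈-filter⁺ (irregularIndependent? G) (subsets-complete pair)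
            (independent u≁v , irregular)))))
      where
      pair = ⁅ u ⁆ ∪ ⁅ v ⁆

      pair⁻ : ∀ {w} → w ∈ₛ pair → w ≡ u ⊎ w ≡ v
      pair⁻ w∈ with x∈p∪q⁻ ⁅ u ⁆ ⁅ v ⁆ w∈
      ... | inj₁ w∈u = inj₁ (x∈⁅y⁆⇒x≡y u w∈u)
      ... | inj₂ w∈v = inj₂ (x∈⁅y⁆⇒x≡y v w∈v)

      pair-large : u ≢ v → 1 < ∣ pair ∣
      pair-large u≢v = subst (_< ∣ pair ∣) (∣⁅x⁆∣≡1 u) (p⊂q⇒∣p∣<∣q∣
        (p⊆p∪q ⁅ v ⁆ , v , q⊆p∪q ⁅ u ⁆ ⁅ v ⁆ (x∈⁅x⁆ v) , u≢v ∘ sym ∘ x∈⁅y⁆⇒x≡y u))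

      independent : ¬ u ~ v → Independent G pair
      independent u≁v x x∈ y y∈ x~y with pair⁻ x∈ | pair⁻ y∈
      ... | inj₁ refl | inj₁ refl = ~-irrefl refl x~y
      ... | inj₁ refl | inj₂ refl = u≁v x~y
      ... | inj₂ refl | inj₁ refl = u≁v (~-sym x~y)
      ... | inj₂ refl | inj₂ refl = ~-irrefl refl x~y

      irregular : ∀ x → x ∈ₛ pair → ∀ y → y ∈ₛ pair → x ≢ y → degree G x ≢ degree G y
      irregular x x∈ y y∈ x≢y with pair⁻ x∈ | pair⁻ y∈
      ... | inj₁ refl | inj₁ refl = contradiction refl x≢y
      ... | inj₁ refl | inj₂ refl = du≢dv
      ... | inj₂ refl | inj₁ refl = du≢dv ∘ sym
      ... | inj₂ refl | inj₂ refl = contradiction refl x≢y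

    -- Every vertex either has the degree of `v`, as `v` itself does, or is a neighbour of `v`. The
    -- two classes may overlap, hence an inequality.
    order≤countOfDegree+degree : ∀ v → order ≤ countOfDegree G (degree G v) + degree G v
    order≤countOfDegree+degree v = begin
      order                                            ≡⟨ length-tabulate id ⟨
      length (allFin order)                            ≤⟨ length-filter-cover (λ w → degree G w ℕ.≟ degree G v)
                                                            (v ~?_) same⊎adjacent (allFin order) ⟩
      countOfDegree G (degree G v) + length (filter (v ~?_) (allFin order))
                                                       ≡⟨ cong (countOfDegree G (degree G v) +_)
                                                            (length-filter-tabulate (v ~?_) id) ⟨
      countOfDegree G (degree G v) + degree G v        ∎
      where
      open ≤-Reasoning
      same⊎adjacent : ∀ w → degree G w ≡ degree G v ⊎ v ~ w
      same⊎adjacent w with degree G w ℕ.≟ degree G v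
      ... | yes eq = inj₁ eq
      ... | no  ne = inj₂ (degree-≢⇒~ v w (ne ∘ sym))

    order∸k≤countOfDegree : ∀ {k} → k ∈ D G → order ∸ k ≤ countOfDegree G k
    order∸k≤countOfDegree k∈D with v , refl ← ∈D⇒degree k∈D =
      m≤n+o⇒m∸n≤o order (degree G v)
        (≤-trans (order≤countOfDegree+degree v) (≤-reflexive (+-comm _ (degree G v))))

    -- Sums (i) over all degrees: the classes of vertices of equal degree are disjoint, so their
    -- sizes add up to at most the order.
    sum-D≤order : sum (map (order ∸_) (D G)) ≤ order
    sum-D≤order = begin
      sum (map (order ∸_) (D G))                            ≤⟨ sum-map-mono (All.tabulate order∸k≤countOfDegree) ⟩
      sum (map (fibre (degree G) (allFin order)) (D G))     ≤⟨ sum-fibres≤length (degree G) (allFin order) D-unique ⟩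
      length (allFin order)                                 ≡⟨ length-tabulate id ⟩
      order                                                 ∎
      where open ≤-Reasoning

    span-bound : ∃[ t ] (span G ≡ suc t × t * suc t ≤ 2 * minDegree G)
    span-bound
      -- The minimum degree is split off `D G`; the other degrees `ks` are one fewer than the span.
      with ks , D↭ ← ∈⇒↭∷ minDegree∈D
      with _ ∷ uniq ← Unique-↭ D↭ D-unique
         | δ<n ∷ bound ← All-resp-↭ D↭ D<order
      = length ks , ↭-length D↭ , ≤-trans (triangular≤2*sum order uniq bound) (*-monoʳ-≤ 2 sum≤δ)
      where
      open ≤-Reasoning
      δ = minDegree G
      sum≤δ : sum (map (order ∸_) ks) ≤ δ
      -- The summand of the minimum degree cancels against the order, written as `(order ∸ δ) + δ`;
      -- this is exact because δ is below the order.
      sum≤δ = +-cancelˡ-≤ (order ∸ δ) _ _ (begin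
        (order ∸ δ) + sum (map (order ∸_) ks)   ≡⟨ sum-↭ (map⁺ (order ∸_) D↭) ⟨
        sum (map (order ∸_) (D G))              ≤⟨ sum-D≤order ⟩
        order                                   ≡⟨ m∸n+n≡m (<⇒≤ δ<n) ⟨
        (order ∸ δ) + δ                         ∎)

-- The embedding of ℕ into ℚ

ι : ℕ → ℚ
ι n = ℤ.+ n ℚ./ 1

-- Normalising `ι n` involves a gcd that is stuck for a variable `n`; rewriting to this explicit
-- fraction lets the rational operations compute.
ι≡mkℚ : ∀ n → ι n ≡ mkℚ (ℤ.+ n) 0 (Coprime.sym (1-coprimeTo n))
ι≡mkℚ n = ℚ.normalize-coprime (Coprime.sym (1-coprimeTo n))

ι-+ : ∀ m n → ι m ℚ.+ ι n ≡ ι (m + n)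
ι-+ m n rewrite ι≡mkℚ m | ι≡mkℚ n =
  cong (ℚ._/ 1) (cong₂ ℤ._+_ (ℤ.*-identityʳ (ℤ.+ m)) (ℤ.*-identityʳ (ℤ.+ n)))

ι-* : ∀ m n → ι m ℚ.* ι n ≡ ι (m * n)
ι-* m n rewrite ι≡mkℚ m | ι≡mkℚ n = cong (ℚ._/ 1) (sym (ℤ.pos-* m n))

ι-mono-≤ : ∀ {m n} → m ≤ n → ι m ℚ.≤ ι n
ι-mono-≤ {m} {n} m≤n rewrite ι≡mkℚ m | ι≡mkℚ n = ℚ.*≤* (ℤ.*-monoʳ-≤-nonNeg (ℤ.+ 1) (ℤ.+≤+ m≤n))

-- The endpoint s of the cut fromℕ s, moved to the cut of √ℕ a.
2*s-1 : ∀ t → ℚ.- 1ℚ ℚ.+ (ι 2 ℚ.* ι (suc t)) ≡ ι (1 + 2 * t)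
2*s-1 t = begin
  ℚ.- 1ℚ ℚ.+ (ι 2 ℚ.* ι (suc t))         ≡⟨ cong (ℚ.- 1ℚ ℚ.+_) (trans (ι-* 2 (suc t)) (cong ι (double t))) ⟩
  ℚ.- 1ℚ ℚ.+ ι (1 + (1 + 2 * t))         ≡⟨ cong (ℚ.- 1ℚ ℚ.+_) (ι-+ 1 (1 + 2 * t)) ⟨
  ℚ.- 1ℚ ℚ.+ (1ℚ ℚ.+ ι (1 + 2 * t))      ≡⟨ ℚ.+-assoc (ℚ.- 1ℚ) 1ℚ (ι (1 + 2 * t)) ⟨
  (ℚ.- 1ℚ ℚ.+ 1ℚ) ℚ.+ ι (1 + 2 * t)      ≡⟨ ℚ.+-identityˡ (ι (1 + 2 * t)) ⟩
  ι (1 + 2 * t)                          ∎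
  where
  open ≡-Reasoning
  double : ∀ t → 2 * suc t ≡ 1 + (1 + 2 * t)
  double = solve-∀

-- Comparison of a natural number with ½ (1 + √ a).

suc-≤½[1+√] : ∀ t a → (1 + 2 * t) * (1 + 2 * t) ≤ a → fromℕ (suc t) ≤ℝ ½ ⊛ (1ℚ ⊕ √ℕ a)
suc-≤½[1+√] t a m²≤a q q<s =
  -- The lower cut on the right asks for a rational r with 2 q - 1 < r and r² ≤ a. With s = `suc t`,
  -- the choice r = 2 s - 1 works since q < s.
  ι (1 + 2 * t) ,
  subst (ℚ.- 1ℚ ℚ.+ ι 2 ℚ.* q ℚ.<_) (2*s-1 t)
    (ℚ.+-monoʳ-< (ℚ.- 1ℚ) (ℚ.*-monoʳ-<-pos (ι 2) q<s)) ,
  subst (ℚ._≤ ι a) (sym (ι-* (1 + 2 * t) (1 + 2 * t))) (ι-mono-≤ m²≤a)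

½[1+√]-≤suc : ∀ t → ½ ⊛ (1ℚ ⊕ √ℕ ((1 + 2 * t) * (1 + 2 * t))) ≤ℝ fromℕ (suc t)
-- If s = `suc t` were at most q, then m = 2 s - 1 ≤ 2 q - 1 < r would give m² < r², against r² ≤
-- m².
½[1+√]-≤suc t q (r , 2q-1<r , r²≤m²) = ℚ.≰⇒> λ s≤q →
  let m<r : ι (1 + 2 * t) ℚ.< r
      m<r = ℚ.≤-<-trans (subst (ℚ._≤ ℚ.- 1ℚ ℚ.+ ι 2 ℚ.* q) (2*s-1 t)
              (ℚ.+-monoʳ-≤ (ℚ.- 1ℚ) (ℚ.*-monoˡ-≤-nonNeg (ι 2) s≤q))) 2q-1<r
  in ℚ.<-irrefl refl (ℚ.<-≤-trans
       (subst (ℚ._< r ℚ.* r) (ι-* (1 + 2 * t) (1 + 2 * t)) (square-< (ι-mono-≤ {0} {1 + 2 * t} z≤n) m<r)) r²≤m²)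
  where
  square-< : ∀ {x y} → 0ℚ ℚ.≤ x → x ℚ.< y → x ℚ.* x ℚ.< y ℚ.* y
  square-< {x} {y} 0≤x x<y = ℚ.≤-<-trans
    (ℚ.*-monoˡ-≤-nonNeg x {{ℚ.nonNegative 0≤x}} (ℚ.<⇒≤ x<y))
    (ℚ.*-monoˡ-<-pos y {{ℚ.positive (ℚ.≤-<-trans 0≤x x<y)}} x<y)

-- The extremal graph and the final bounds.

K₁ : Graph
K₁ = record
  { order    = 1
  ; _~_      = λ _ _ → ⊥
  ; _~?_     = λ _ _ → no λ ()
  ; ~-sym    = λ ()
  ; ~-irrefl = λ _ ()
  }

theorem3p2 : (∀ (G : Graph) (n δ : ℕ) → Graph.order G ≡ n → minDegree G ≡ δ → α-ir G ≡ 1 →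
    (∀ k → k ∈ D G → countOfDegree G k ≥ n ∸ k)
    × fromℕ (span G) ≤ℝ ½ ⊛ (1ℚ ⊕ √ℕ (1 + 8 * δ)))
    × (∃[ G ] (α-ir G ≡ 1 × fromℕ (span G) ≈ℝ ½ ⊛ (1ℚ ⊕ √ℕ (1 + 8 * minDegree G))))
-- For `K₁` the span is 1 and the minimum degree 0, so t = 0 and the radicand 1 + 8 * 0 is (1 + 2 *
-- 0)²; both sides equal 1.
theorem3p2 = bounds , K₁ , refl , suc-≤½[1+√] 0 1 ≤-refl , ½[1+√]-≤suc 0
  where
  -- Completes the square: t (t + 1) ≤ 2 δ becomes (2 t + 1)² ≤ 1 + 8 δ.
  odd-square : ∀ t → (1 + 2 * t) * (1 + 2 * t) ≡ 1 + 4 * (t * suc t)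
  odd-square = solve-∀

  bounds : ∀ (G : Graph) (n δ : ℕ) → Graph.order G ≡ n → minDegree G ≡ δ → α-ir G ≡ 1 →
    (∀ k → k ∈ D G → countOfDegree G k ≥ n ∸ k)
    × fromℕ (span G) ≤ℝ ½ ⊛ (1ℚ ⊕ √ℕ (1 + 8 * δ))
  bounds G _ δ refl refl α≡1 =
    (λ k → order∸k≤countOfDegree G α≡1) ,
    subst (λ s → fromℕ s ≤ℝ ½ ⊛ (1ℚ ⊕ √ℕ (1 + 8 * δ))) (sym s≡1+t) (suc-≤½[1+√] t (1 + 8 * δ) (begin
      (1 + 2 * t) * (1 + 2 * t)   ≡⟨ odd-square t ⟩
      1 + 4 * (t * suc t)         ≤⟨ s≤s (*-monoʳ-≤ 4 t[1+t]≤2δ) ⟩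
      1 + 4 * (2 * δ)             ≡⟨ cong suc (*-assoc 4 2 δ) ⟨
      1 + 8 * δ                   ∎))
    where
    open ≤-Reasoning
    t = proj₁ (span-bound G α≡1)
    s≡1+t = proj₁ (proj₂ (span-bound G α≡1))
    t[1+t]≤2δ = proj₂ (proj₂ (span-bound G α≡1))
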